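{- $\log\mathrm{Time}(s)\in O(\mathrm{Space}(s))$; that is, there is a constant $c$ such that for every term $s$ that reduces to an abstraction in at least one step, $\log\mathrm{Time}(s)\le c\cdot\mathrm{Space}(s)$.
   Context: $\mathsf{L}$-terms (de Bruijn): $s::=n\mid st\mid\lambda s$, size $|n|=1+n$, $|\lambda s|=1+|s|$, $|st|=1+|s|+|t|$. Substitution $k^k_u=u$, $n^k_u=n$ ($n\ne k$), $(st)^k_u=(s^k_u)(t^k_u)$, $(\lambda s)^k_u=\lambda(s^{k+1}_u)$. Reduction (deterministic): $(\lambda s)(\lambda t)\succ s^0_{\lambda t}$; $s\succ s'\Rightarrow st\succ s't$; $t\succ t'\Rightarrow(\lambda s)t\succ(\lambda s)t'$. If $s=s_0\succ\cdots\succ s_j$ with $s_j$ an abstraction, then $\mathrm{Time}(s)=j$ and $\mathrm{Space}(s)=\max_i|s_i|$. -}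

module Defs where

open import Data.Bool.Base using (if_then_else_)
open import Data.Nat.Base using (ℕ; suc; _+_; _⊔_)
open import Data.Nat.Properties using (_≟_)
open import Data.Product.Base using (_×_; _,_)
open import Relation.Binary.Construct.Closure.ReflexiveTransitive using (Star; ε; _◅_)
open import Relation.Binary.PropositionalEquality using (_≡_; refl; cong)
open import Relation.Nullary.Decidable.Core using (does)

infixl 7 _·_
infix  8 _[_≔_]
infix  4 _≻_ _≻*_

data Term : Set where
  var : ℕ → Term
  _·_ : Term → Term → Term
  ƛ_  : Term → Term

-- A variable costs its index (unary encoding), so only finitely many terms
-- have a given size.
∣_∣ : Term → ℕ
∣ var n ∣ = 1 + n
∣ s · t ∣ = 1 + ∣ s ∣ + ∣ t ∣
∣ ƛ s ∣   = 1 + ∣ s ∣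

-- Simple substitution: u is not shifted under binders and the remaining
-- indices are not lowered, so this is capture-avoiding only for closed u.
_[_≔_] : Term → ℕ → Term → Term
var n   [ k ≔ u ] = if does (n ≟ k) then u else var n
(s · t) [ k ≔ u ] = (s [ k ≔ u ]) · (t [ k ≔ u ])
(ƛ s)   [ k ≔ u ] = ƛ (s [ suc k ≔ u ])

data _≻_ : Term → Term → Set where
  β  : ∀ {s t} → (ƛ s) · (ƛ t) ≻ s [ 0 ≔ ƛ t ]
  ξˡ : ∀ {s s′ t} → s ≻ s′ → s · t ≻ s′ · t
  ξʳ : ∀ {s t t′} → t ≻ t′ → (ƛ s) · t ≻ (ƛ s) · t′

_≻*_ : Term → Term → Set
_≻*_ = Star _≻_

data IsAbstraction : Term → Set where
  ƛ_ : ∀ s → IsAbstraction (ƛ s)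

record Evaluation (s : Term) : Set where
  constructor evaluation
  field
    {value}     : Term
    chain       : s ≻* value
    abstraction : IsAbstraction value

steps : ∀ {s t} → s ≻* t → ℕ
steps ε       = 0
steps (_ ◅ r) = suc (steps r)

maxSize : ∀ {s t} → s ≻* t → ℕ
maxSize {s} ε       = ∣ s ∣
maxSize {s} (_ ◅ r) = ∣ s ∣ ⊔ maxSize r

-- Time and Space are partial functions of s: the evaluation witnesses that
-- they are defined at s, and by Time-Space-unique the choice is immaterial.
Time : ∀ s → Evaluation s → ℕ
Time s e = steps (Evaluation.chain e)

Space : ∀ s → Evaluation s → ℕ
Space s e = maxSize (Evaluation.chain e)

≻-deterministic : ∀ {s t t′} → s ≻ t → s ≻ t′ → t ≡ t′
≻-deterministic β      β      = refl
≻-deterministic (ξˡ p) (ξˡ q) = cong (_· _) (≻-deterministic p q)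
≻-deterministic (ξʳ p) (ξʳ q) = cong (_ ·_) (≻-deterministic p q)

Time-Space-unique : ∀ s (e e′ : Evaluation s) →
                    Time s e ≡ Time s e′ × Space s e ≡ Space s e′
Time-Space-unique s (evaluation r a) (evaluation r′ a′) = unique r a r′ a′
  where
  unique : ∀ {s t t′} (r : s ≻* t) → IsAbstraction t →
           (r′ : s ≻* t′) → IsAbstraction t′ →
           steps r ≡ steps r′ × maxSize r ≡ maxSize r′
  unique ε        _     ε         _  = refl , refl
  unique ε        (ƛ _) (() ◅ _)  _
  unique (() ◅ _) _     ε         (ƛ _)
  unique (p ◅ r)  a     (p′ ◅ r′) a′ with refl ← ≻-deterministic p p′
                                     with (eqT , eqS) ← unique r a r′ a′
    = cong suc eqT , cong (_ ⊔_) eqS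

{-# OPTIONS --safe #-}
-- The terms visited by an evaluation are pairwise distinct, since reduction is
-- deterministic and so each visited term determines the number of steps left.
-- A prefix-free code over four letters assigns a word of length ∣ s ∣ to each term s,
-- so at most 5 ^ m terms of size at most m can be visited.
module Submission where

open import Defs
open import Data.Nat.Base using (ℕ; _*_; _≤_; _≥_)
open import Data.Nat.Logarithm using (⌈log₂_⌉)
open import Data.Product.Base using (∃-syntax)

open import Data.Fin.Base using (Fin; zero; suc; toℕ; fromℕ<)
open import Data.Fin.Patterns using (0F; 1F; 2F; 3F)
open import Data.Fin.Properties
  using (toℕ<n; toℕ-injective; fromℕ<-injective; injective⇒≤)
open import Data.List.Base using (List; []; _∷_; length)
open import Data.List.Properties using (∷-injectiveʳ)
open import Data.Nat.Base using (zero; suc; _+_; _^_; _<_; s≤s; z≤n; NonZero)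
open import Data.Nat.DivMod using (_%_; [m+kn]%n≡m%n; m<n⇒m%n≡m)
open import Data.Nat.Logarithm using (⌈log₂⌉-mono-≤; ⌈log₂2^n⌉≡n)
open import Data.Nat.Properties
  using ( ≤-refl; ≤-trans; <⇒≤; <-≤-trans; m≤m+n; m≤m⊔n; m≤n⊔m; +-assoc; +-suc
        ; +-identityʳ; +-cancelˡ-≡; +-monoˡ-<; *-comm; *-cancelʳ-≡; *-monoˡ-≤
        ; ^-*-assoc; ^-monoˡ-≤; ^-monoʳ-≤; module ≤-Reasoning)
open import Data.Product.Base using (_×_; _,_; proj₁)
open import Function.Definitions using (Injective)
open import Relation.Binary.Construct.Closure.ReflexiveTransitive using (ε; _◅_)
open import Relation.Binary.PropositionalEquality
  using (_≡_; refl; sym; trans; cong; module ≡-Reasoning)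

[toℕ+kn]%n≡toℕ : ∀ {n} .{{_ : NonZero n}} (d : Fin n) k → (toℕ d + k * n) % n ≡ toℕ d
[toℕ+kn]%n≡toℕ {n} d k = trans ([m+kn]%n≡m%n (toℕ d) k n) (m<n⇒m%n≡m (toℕ<n d))

-- Reducing modulo `n` recovers the low digit, since `toℕ d < n`; cancelling it then recovers the
-- quotient.
toℕ-+-*-injective : ∀ {n} .{{_ : NonZero n}} (d d′ : Fin n) k k′ →
                    toℕ d + k * n ≡ toℕ d′ + k′ * n → d ≡ d′ × k ≡ k′
toℕ-+-*-injective {n} d d′ k k′ eq
  with refl ← toℕ-injective
    (trans (sym ([toℕ+kn]%n≡toℕ d k)) (trans (cong (_% n) eq) ([toℕ+kn]%n≡toℕ d′ k′)))
  = refl , *-cancelʳ-≡ k k′ n (+-cancelˡ-≡ (toℕ d) (k * n) (k′ * n) eq)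

toℕ-+-*-bound : ∀ {n m k} (d : Fin n) → k < n ^ m → toℕ d + k * n < n ^ suc m
toℕ-+-*-bound {n} {m} {k} d k<n^m = begin-strict
  toℕ d + k * n  <⟨ +-monoˡ-< (k * n) (toℕ<n d) ⟩
  -- `n + k * n` is `suc k * n`, and `k < n ^ m` is `suc k ≤ n ^ m`.
  n + k * n      ≤⟨ *-monoˡ-≤ n k<n^m ⟩
  n ^ m * n      ≡⟨ *-comm (n ^ m) n ⟩
  n ^ suc m      ∎
  where open ≤-Reasoning

-- Base 1 + n with nonzero digits, so that words of different lengths get different values.
value : ∀ {n} → List (Fin n) → ℕ
value         []      = 0
value {n = n} (d ∷ w) = toℕ (suc d) + value w * suc n

-- A nonempty word never gets the value 0 of the empty one, as its lowest digit is a successor;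
-- otherwise digits are peeled off from the low end.
value-injective : ∀ {n} → Injective _≡_ _≡_ (value {n})
value-injective {x = []}    {[]}      _  = refl
value-injective {x = d ∷ w} {d′ ∷ w′} eq
  with refl , eq′ ← toℕ-+-*-injective (suc d) (suc d′) (value w) (value w′) eq
  = cong (d ∷_) (value-injective eq′)

value-bound : ∀ {n} (w : List (Fin n)) → value w < suc n ^ length w
value-bound []      = s≤s z≤n
value-bound (d ∷ w) = toℕ-+-*-bound {m = length w} (suc d) (value-bound w)

-- Polish prefix notation with variables in unary, so that each letter pays for one unit of size.
-- The second argument is the text that follows the term.
encode : Term → List (Fin 4) → List (Fin 4)
encode (var zero)    w = 0F ∷ w
encode (var (suc n)) w = 1F ∷ encode (var n) w
encode (s · t)       w = 2F ∷ encode s (encode t w)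
encode (ƛ s)         w = 3F ∷ encode s w

-- The first letter determines the constructor. The remainder is recovered along with the term
-- because, in an application, the code of `t` begins where that of `s` ends.
encode-injective : ∀ s s′ {w w′} → encode s w ≡ encode s′ w′ → s ≡ s′ × w ≡ w′
encode-injective (var zero) (var zero) refl = refl , refl
encode-injective (var (suc n)) (var (suc n′)) eq
  with refl , refl ← encode-injective (var n) (var n′) (∷-injectiveʳ eq) = refl , refl
encode-injective (s · t) (s′ · t′) eq
  with refl , eq′ ← encode-injective s s′ (∷-injectiveʳ eq)
  with refl , refl ← encode-injective t t′ eq′ = refl , refl
encode-injective (ƛ s) (ƛ s′) eq
  with refl , refl ← encode-injective s s′ (∷-injectiveʳ eq) = refl , refl
encode-injective (var zero)    (var (suc _)) ()
encode-injective (var (suc _)) (var zero)    ()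
encode-injective (_ · _)       (var zero)    ()
encode-injective (_ · _)       (var (suc _)) ()
encode-injective (ƛ _)         (var zero)    ()
encode-injective (ƛ _)         (var (suc _)) ()

length-encode : ∀ s w → length (encode s w) ≡ ∣ s ∣ + length w
length-encode (var zero)    w = refl
length-encode (var (suc n)) w = cong suc (length-encode (var n) w)
length-encode (s · t)       w = cong suc (begin
  length (encode s (encode t w))   ≡⟨ length-encode s (encode t w) ⟩
  ∣ s ∣ + length (encode t w)      ≡⟨ cong (∣ s ∣ +_) (length-encode t w) ⟩
  ∣ s ∣ + (∣ t ∣ + length w)       ≡⟨ +-assoc ∣ s ∣ ∣ t ∣ (length w) ⟨
  ∣ s ∣ + ∣ t ∣ + length w         ∎)
  where open ≡-Reasoning
length-encode (ƛ s)         w = cong suc (length-encode s w)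

code : Term → ℕ
code s = value (encode s [])

code-injective : Injective _≡_ _≡_ code
code-injective {s} {s′} eq = proj₁ (encode-injective s s′ (value-injective eq))

-- Base 5 arises because the four letters are the digits 1 to 4.
code-bound : ∀ s → code s < 5 ^ ∣ s ∣
code-bound s = begin-strict
  code s                    <⟨ value-bound (encode s []) ⟩
  5 ^ length (encode s [])  ≡⟨ cong (5 ^_) (length-encode s []) ⟩
  5 ^ (∣ s ∣ + 0)           ≡⟨ cong (5 ^_) (+-identityʳ ∣ s ∣) ⟩
  5 ^ ∣ s ∣                 ∎
  where open ≤-Reasoning

-- A chain of `n` steps visits `n + 1` terms, both ends included.
state : ∀ {s t} (r : s ≻* t) → Fin (suc (steps r)) → Term
state {s} r zero      = s
state (_ ◅ r) (suc i) = state r i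

suffix : ∀ {s t} (r : s ≻* t) i → state r i ≻* t
suffix r zero          = r
suffix (_ ◅ r) (suc i) = suffix r i

steps-suffix : ∀ {s t} (r : s ≻* t) i → steps (suffix r i) + toℕ i ≡ steps r
steps-suffix r zero          = +-identityʳ (steps r)
steps-suffix (_ ◅ r) (suc i) =
  trans (+-suc (steps (suffix r i)) (toℕ i)) (cong suc (steps-suffix r i))

state-size : ∀ {s t} (r : s ≻* t) i → ∣ state r i ∣ ≤ maxSize r
state-size ε zero              = ≤-refl
state-size {s} (_ ◅ r) zero    = m≤m⊔n ∣ s ∣ (maxSize r)
state-size {s} (_ ◅ r) (suc i) = ≤-trans (state-size r i) (m≤n⊔m ∣ s ∣ (maxSize r))

-- The equation is an argument so that it can later relate `state r i` and `state r j`, where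
-- matching on `refl` directly would get stuck.
Time-cong : ∀ {s s′} (e : Evaluation s) (e′ : Evaluation s′) → s ≡ s′ → Time s e ≡ Time s′ e′
Time-cong e e′ refl = proj₁ (Time-Space-unique _ e e′)

-- The time left at a position and the position itself add up to `steps r`, so equal time left
-- forces equal positions. As `t` is an abstraction, each suffix is an evaluation.
state-injective : ∀ {s t} (r : s ≻* t) → IsAbstraction t → Injective _≡_ _≡_ (state r)
state-injective r a {i} {j} eq = toℕ-injective (+-cancelˡ-≡ (steps (suffix r i)) _ _ (begin
  steps (suffix r i) + toℕ i  ≡⟨ steps-suffix r i ⟩
  steps r                     ≡⟨ steps-suffix r j ⟨
  steps (suffix r j) + toℕ j  ≡⟨ cong (_+ toℕ j) same-time ⟨
  steps (suffix r i) + toℕ j  ∎))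
  where
  open ≡-Reasoning
  same-time : steps (suffix r i) ≡ steps (suffix r j)
  same-time = Time-cong (evaluation (suffix r i) a) (evaluation (suffix r j) a) eq

Time<5^Space : ∀ s (e : Evaluation s) → Time s e < 5 ^ Space s e
-- Pigeonhole gives `suc (steps r) ≤ 5 ^ maxSize r`, which is the strict inequality.
Time<5^Space s (evaluation r a) = injective⇒≤ {f = index} index-injective
  where
  bound : ∀ i → code (state r i) < 5 ^ maxSize r
  bound i = <-≤-trans (code-bound (state r i)) (^-monoʳ-≤ 5 (state-size r i))

  index : Fin (suc (steps r)) → Fin (5 ^ maxSize r)
  index i = fromℕ< (bound i)

  index-injective : Injective _≡_ _≡_ index
  index-injective {i} {j} eq =
    state-injective r a (code-injective (fromℕ<-injective _ _ (bound i) (bound j) eq))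

theorem21 : ∃[ c ] (∀ (s : Term) (e : Evaluation s) → Time s e ≥ 1 → ⌈log₂ Time s e ⌉ ≤ c * Space s e)
-- Rounding 5 up to 8 = 2 ^ 3 gives a power of 2, whose logarithm is exact; hence the constant 3.
theorem21 = 3 , λ s e _ → begin
  ⌈log₂ Time s e ⌉             ≤⟨ ⌈log₂⌉-mono-≤ (<⇒≤ (Time<5^Space s e)) ⟩
  ⌈log₂ 5 ^ Space s e ⌉        ≤⟨ ⌈log₂⌉-mono-≤ (^-monoˡ-≤ (Space s e) (m≤m+n 5 3)) ⟩
  ⌈log₂ 8 ^ Space s e ⌉        ≡⟨ cong ⌈log₂_⌉ (^-*-assoc 2 3 (Space s e)) ⟩
  ⌈log₂ 2 ^ (3 * Space s e) ⌉  ≡⟨ ⌈log₂2^n⌉≡n (3 * Space s e) ⟩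
  3 * Space s e                ∎
  where open ≤-Reasoning
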